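{- For positive integers $n$ and $r$ let $$S(n,r):=\sum_{k=0}^{n}\frac{r}{k+r}\binom{n}{k}\in\mathbb{Q}.$$ Then: (i) $S(n,r)$ is not an integer for any $r\in\{1,2,3,4,5,6\}$ and any integer $n\ge 2$; (ii) $S(n,r)$ is not an integer for any integers $n,r$ with $1\le n\le r-1$.
   Context: Here $\binom{n}{k}$ is the usual binomial coefficient. -}

module Defs where

open import Algebra.Bundles using (CommutativeMonoid)
open import Data.Fin.Base using (toℕ)
open import Data.Integer.Base using (+_)
open import Data.Nat.Base using (ℕ; NonZero; _+_; >-nonZero; >-nonZero⁻¹)
open import Data.Nat.Combinatorics using (_C_)
open import Data.Nat.Properties using (m≤n+m; ≤-trans)
open import Data.Product.Base using (∃-syntax)
open import Data.Rational.Base using (ℚ; _/_; _*_)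
open import Data.Rational.Properties using (+-0-commutativeMonoid)
open import Relation.Binary.PropositionalEquality.Core using (_≡_)

open import Algebra.Properties.Monoid.Sum (CommutativeMonoid.monoid +-0-commutativeMonoid) using (sum⁺-syntax)

m+n≢0 : ∀ m n .{{_ : NonZero n}} → NonZero (m + n)
m+n≢0 m n = >-nonZero (≤-trans (>-nonZero⁻¹ n) (m≤n+m n m))

term : (n r k : ℕ) .{{_ : NonZero r}} → ℚ
term n r k = (+ r / (k + r)) {{m+n≢0 k r}} * (+ (n C k) / 1)

-- The index of ∑[ k ≤ n ] ranges over Fin (suc n), i.e. over 0, …, n.
S : (n r : ℕ) .{{_ : NonZero r}} → ℚ
S n r = ∑[ k ≤ n ] term n r (toℕ k)

IsInteger : ℚ → Set
IsInteger q = ∃[ z ] q ≡ z / 1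

{-# OPTIONS --safe #-}

-- Since S n r = r ∫₀¹ xʳ⁻¹ (1 + x)ⁿ dx, integration by parts shows that S n r · (N C n) is the
-- alternating sum T n N = (−1)ⁿ ∑_{i ≤ n} (−2)ⁱ (N C i), where N = n + r. So S n r is not an
-- integer as soon as some prime divides N C n but not T n N.
--
-- If a prime power q = pᵉ > n divides one of r + 1, …, r + n, then modulo p the row N of Pascal's
-- triangle agrees up to column n with the row t = N mod q < n. Hence p divides N C n, while
-- T n N ≡ ±(1 − 2)ᵗ. For n < r such a q exists: otherwise r + 1, …, r + n all divide every common
-- multiple of 1, …, n, and then so does n (N C n), by the harmonic triangle identity
-- 1/(n (N C n)) = ∑ⱼ ±((n − 1) C (j − 1))/(r + j). But n (N C n) > 4ⁿ⁻¹, and 1, …, n have a common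
-- multiple that is at most 4ⁿ⁻¹.
--
-- For r ≤ 6 either n and r are odd, and then N C n is even and T n N is odd, or some m among
-- n + 1, …, n + r has no prime factor ≤ r. The least prime factor p of such an m divides N C n,
-- and T n N ≡ ±(2ᵐ − 1) modulo p, which is not 0 because m is coprime to p − 1.
module Submission where

open import Algebra.Bundles using (CommutativeRing)
open import Data.Fin.Base using (Fin; toℕ; inject₁; fromℕ)
open import Data.Fin.Properties using (toℕ-inject₁; toℕ-fromℕ)
open import Data.Integer.Base as ℤ using (ℤ; +_)
import Data.Integer.Divisibility.Signed as ℤ∣
import Data.Integer.Properties as ℤ
open import Data.Integer.Tactic.RingSolver using () renaming (solve-∀ to ℤ-solve-∀)
open import Data.Nat.Base
open import Data.Nat.Combinatorics using (_C_; nCk+nC[k+1]≡[n+1]C[k+1]; k>n⇒nCk≡0; nCk≡nC[n∸k]; nCn≡1)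
open import Data.Nat.Coprimality using (Coprime; coprime-Bézout)
open import Data.Nat.Divisibility
open import Data.Nat.DivMod using (_%_; _/_; m≡m%n+[m/n]*n; m%n<n)
open import Data.Nat.GCD using (gcd; gcd[m,n]∣m; gcd[m,n]∣n; gcd-greatest; module Bézout)
open import Data.Nat.Induction using (<-rec)
open import Data.Nat.Primality
open import Data.Nat.Properties
open import Data.Nat.Tactic.RingSolver using (solve-∀)
open import Data.Product.Base using (_,_; _×_; ∃-syntax)
open import Data.Rational.Base as ℚ using (ℚ; fromℚᵘ; toℚᵘ; 0ℚ; 1ℚ)
import Data.Rational.Properties as ℚ
open import Data.Rational.Solver using (module +-*-Solver)
open import Data.Rational.Unnormalised.Base as ℚᵘ using (mkℚᵘ; *≡*)
import Data.Rational.Unnormalised.Properties as ℚᵘ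
open import Data.Sum.Base using (_⊎_; inj₁; inj₂)
open import Defs
open import Function.Base using (_∘_)
open import Relation.Binary.PropositionalEquality
open import Relation.Nullary.Decidable using (yes; no; decidable-stable; from-yes; ¬?; _×-dec_; _⊎-dec_; _→-dec_)
open import Relation.Nullary.Negation.Core using (¬_; contradiction)

open import Algebra.Properties.Semiring.Sum (CommutativeRing.semiring ℚ.+-*-commutativeRing)
  using (sum; sum-cong-≗; sum-init-last; ∑-distrib-+; *-distribˡ-sum; sum⁺-syntax)

[1+k]*[1+n]C[1+k]≡[1+n]*nCk : ∀ n k → suc k * (suc n C suc k) ≡ suc n * (n C k)
[1+k]*[1+n]C[1+k]≡[1+n]*nCk zero zero = refl
[1+k]*[1+n]C[1+k]≡[1+n]*nCk zero (suc k) = *-zeroʳ (suc (suc k))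
[1+k]*[1+n]C[1+k]≡[1+n]*nCk (suc n) zero = begin
  1 * (suc (suc n) C 1)                 ≡⟨ cong (1 *_) (nCk+nC[k+1]≡[n+1]C[k+1] (suc n) 0) ⟨
  1 * (suc n C 0 + suc n C 1)           ≡⟨ *-distribˡ-+ 1 (suc n C 0) (suc n C 1) ⟩
  1 * 1 + 1 * (suc n C 1)               ≡⟨ cong (_+_ 1) ([1+k]*[1+n]C[1+k]≡[1+n]*nCk n 0) ⟩
  1 + suc n * 1                         ≡⟨⟩
  suc (suc n) * 1                       ∎
  where open ≡-Reasoning
[1+k]*[1+n]C[1+k]≡[1+n]*nCk (suc n) (suc k) = begin
  suc (suc k) * (suc (suc n) C suc (suc k))
    ≡⟨ cong (suc (suc k) *_) (nCk+nC[k+1]≡[n+1]C[k+1] (suc n) (suc k)) ⟨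
  suc (suc k) * (a + suc n C suc (suc k))
    ≡⟨ *-distribˡ-+ (suc (suc k)) a _ ⟩
  suc (suc k) * a + suc (suc k) * (suc n C suc (suc k))
    ≡⟨ cong₂ (λ x y → a + x + y) ([1+k]*[1+n]C[1+k]≡[1+n]*nCk n k) ([1+k]*[1+n]C[1+k]≡[1+n]*nCk n (suc k)) ⟩
  a + suc n * (n C k) + suc n * (n C suc k)
    ≡⟨ lem a (suc n) (n C k) (n C suc k) ⟩
  a + suc n * (n C k + n C suc k)
    ≡⟨ cong (λ x → a + suc n * x) (nCk+nC[k+1]≡[n+1]C[k+1] n k) ⟩
  suc (suc n) * a ∎
  where
  open ≡-Reasoning
  a = suc n C suc k
  lem : ∀ a m b c → a + m * b + m * c ≡ a + m * (b + c)
  lem = solve-∀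

[1+k]*[k+d]C[1+k]≡d*[k+d]Ck : ∀ k d → suc k * ((k + d) C suc k) ≡ d * ((k + d) C k)
[1+k]*[k+d]C[1+k]≡d*[k+d]Ck k d = +-cancelˡ-≡ (suc k * c) _ _ (begin
  suc k * c + suc k * ((k + d) C suc k)  ≡⟨ *-distribˡ-+ (suc k) c _ ⟨
  suc k * (c + (k + d) C suc k)          ≡⟨ cong (suc k *_) (nCk+nC[k+1]≡[n+1]C[k+1] (k + d) k) ⟩
  suc k * (suc (k + d) C suc k)          ≡⟨ [1+k]*[1+n]C[1+k]≡[1+n]*nCk (k + d) k ⟩
  suc (k + d) * c                        ≡⟨ *-distribʳ-+ c (suc k) d ⟩
  suc k * c + d * c                      ∎)
  where
  open ≡-Reasoning
  c = (k + d) C k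

T : ℕ → ℕ → ℤ
T zero    N = + 1
T (suc n) N = + (2 ^ suc n * (N C suc n)) ℤ.- T n N

ι : ℤ → ℚ
ι z = z ℚ./ 1

ιₙ : ℕ → ℚ
ιₙ n = ι (+ n)

fromℚᵘ-homo-+ : ∀ p q → fromℚᵘ (p ℚᵘ.+ q) ≡ fromℚᵘ p ℚ.+ fromℚᵘ q
fromℚᵘ-homo-+ p q = ℚ.toℚᵘ-injective (begin
  toℚᵘ (fromℚᵘ (p ℚᵘ.+ q))                ≈⟨ ℚ.toℚᵘ-fromℚᵘ (p ℚᵘ.+ q) ⟩
  p ℚᵘ.+ q                                ≈⟨ ℚᵘ.+-cong (ℚ.toℚᵘ-fromℚᵘ p) (ℚ.toℚᵘ-fromℚᵘ q) ⟨
  toℚᵘ (fromℚᵘ p) ℚᵘ.+ toℚᵘ (fromℚᵘ q)    ≈⟨ ℚ.toℚᵘ-homo-+ (fromℚᵘ p) (fromℚᵘ q) ⟨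
  toℚᵘ (fromℚᵘ p ℚ.+ fromℚᵘ q)            ∎)
  where open ℚᵘ.≃-Reasoning

fromℚᵘ-homo-* : ∀ p q → fromℚᵘ (p ℚᵘ.* q) ≡ fromℚᵘ p ℚ.* fromℚᵘ q
fromℚᵘ-homo-* p q = ℚ.toℚᵘ-injective (begin
  toℚᵘ (fromℚᵘ (p ℚᵘ.* q))                ≈⟨ ℚ.toℚᵘ-fromℚᵘ (p ℚᵘ.* q) ⟩
  p ℚᵘ.* q                                ≈⟨ ℚᵘ.*-cong (ℚ.toℚᵘ-fromℚᵘ p) (ℚ.toℚᵘ-fromℚᵘ q) ⟨
  toℚᵘ (fromℚᵘ p) ℚᵘ.* toℚᵘ (fromℚᵘ q)    ≈⟨ ℚ.toℚᵘ-homo-* (fromℚᵘ p) (fromℚᵘ q) ⟨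
  toℚᵘ (fromℚᵘ p ℚ.* fromℚᵘ q)            ∎)
  where open ℚᵘ.≃-Reasoning

ι-homo-+ : ∀ a b → ι (a ℤ.+ b) ≡ ι a ℚ.+ ι b
ι-homo-+ a b = trans (ℚ.fromℚᵘ-cong {mkℚᵘ (a ℤ.+ b) 0} {mkℚᵘ a 0 ℚᵘ.+ mkℚᵘ b 0} (*≡* (lem a b))) (fromℚᵘ-homo-+ (mkℚᵘ a 0) (mkℚᵘ b 0))
  where
  lem : ∀ a b → (a ℤ.+ b) ℤ.* + 1 ≡ (a ℤ.* + 1 ℤ.+ b ℤ.* + 1) ℤ.* + 1
  lem a b = cong (ℤ._* + 1) (sym (cong₂ ℤ._+_ (ℤ.*-identityʳ a) (ℤ.*-identityʳ b)))

ι-homo-* : ∀ a b → ι (a ℤ.* b) ≡ ι a ℚ.* ι b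
ι-homo-* a b = fromℚᵘ-homo-* (mkℚᵘ a 0) (mkℚᵘ b 0)

ι-injective : ∀ {a b} → ι a ≡ ι b → a ≡ b
ι-injective {a} {b} eq with ℚ.fromℚᵘ-injective {mkℚᵘ a 0} {mkℚᵘ b 0} eq
... | *≡* e = trans (sym (ℤ.*-identityʳ a)) (trans e (ℤ.*-identityʳ b))

ιₙ-homo-+ : ∀ a b → ιₙ (a + b) ≡ ιₙ a ℚ.+ ιₙ b
ιₙ-homo-+ a b = trans (cong ι (ℤ.pos-+ a b)) (ι-homo-+ (+ a) (+ b))

ιₙ-homo-* : ∀ a b → ιₙ (a * b) ≡ ιₙ a ℚ.* ιₙ b
ιₙ-homo-* a b = trans (cong ι (ℤ.pos-* a b)) (ι-homo-* (+ a) (+ b))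

i/d*d≡i : ∀ i d .{{_ : NonZero d}} → (i ℚ./ d) ℚ.* ιₙ d ≡ ι i
i/d*d≡i i (suc d) = trans (sym (fromℚᵘ-homo-* (mkℚᵘ i d) (mkℚᵘ (+ suc d) 0)))
  (ℚ.fromℚᵘ-cong {mkℚᵘ i d ℚᵘ.* mkℚᵘ (+ suc d) 0} {mkℚᵘ i 0}
    (*≡* (trans (ℤ.*-identityʳ _) (cong (i ℤ.*_) (cong (λ x → + suc x) (sym (*-identityʳ d)))))))

ℚ*-cancelʳ-ι : ∀ d .{{_ : NonZero d}} {x y} → x ℚ.* ιₙ d ≡ y ℚ.* ιₙ d → x ≡ y
ℚ*-cancelʳ-ι d {x} {y} eq = begin
  x                       ≡⟨ undo x ⟩
  (x ℚ.* ιₙ d) ℚ.* u      ≡⟨ cong (ℚ._* u) eq ⟩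
  (y ℚ.* ιₙ d) ℚ.* u      ≡⟨ undo y ⟨
  y                       ∎
  where
  open ≡-Reasoning
  u = + 1 ℚ./ d
  undo : ∀ z → z ≡ (z ℚ.* ιₙ d) ℚ.* u
  undo z = begin
    z                     ≡⟨ ℚ.*-identityʳ z ⟨
    z ℚ.* 1ℚ              ≡⟨ cong (z ℚ.*_) (i/d*d≡i (+ 1) d) ⟨
    z ℚ.* (u ℚ.* ιₙ d)    ≡⟨ cong (z ℚ.*_) (ℚ.*-comm u (ιₙ d)) ⟩
    z ℚ.* (ιₙ d ℚ.* u)    ≡⟨ ℚ.*-assoc z (ιₙ d) u ⟨
    (z ℚ.* ιₙ d) ℚ.* u    ∎

∑nCk≡2^n : ∀ n → (∑[ k ≤ n ] ιₙ (n C toℕ k)) ≡ ιₙ (2 ^ n)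
∑nCk≡2^n zero = refl
∑nCk≡2^n (suc n) = begin
  1ℚ ℚ.+ (∑[ k ≤ n ] ιₙ (suc n C suc (toℕ k)))
    ≡⟨ cong (1ℚ ℚ.+_) (sum-cong-≗ {suc n} (λ k → trans (cong ιₙ (sym (nCk+nC[k+1]≡[n+1]C[k+1] n (toℕ k)))) (ιₙ-homo-+ (n C toℕ k) (n C suc (toℕ k))))) ⟩
  1ℚ ℚ.+ (∑[ k ≤ n ] (f (toℕ k) ℚ.+ f (suc (toℕ k))))
    ≡⟨ cong (1ℚ ℚ.+_) (∑-distrib-+ {suc n} (λ k → f (toℕ k)) (λ k → f (suc (toℕ k)))) ⟩
  1ℚ ℚ.+ (B ℚ.+ (∑[ k ≤ n ] f (suc (toℕ k))))
    ≡⟨ solve 3 (λ o b c → o :+ (b :+ c) := b :+ (o :+ c)) refl 1ℚ B _ ⟩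
  B ℚ.+ (∑[ k ≤ suc n ] f (toℕ k))
    ≡⟨ cong (B ℚ.+_) (sum-init-last {suc n} (f ∘ toℕ)) ⟩
  B ℚ.+ ((∑[ k ≤ n ] f (toℕ (inject₁ k))) ℚ.+ f (toℕ (fromℕ (suc n))))
    ≡⟨ cong (B ℚ.+_) (cong₂ ℚ._+_ (sum-cong-≗ {suc n} (cong f ∘ toℕ-inject₁)) (cong f (toℕ-fromℕ (suc n)))) ⟩
  B ℚ.+ (B ℚ.+ f (suc n))
    ≡⟨ cong₂ (λ x y → x ℚ.+ (x ℚ.+ y)) (∑nCk≡2^n n) (cong ιₙ (k>n⇒nCk≡0 (n<1+n n))) ⟩
  ιₙ (2 ^ n) ℚ.+ (ιₙ (2 ^ n) ℚ.+ ιₙ 0)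
    ≡⟨ cong (ιₙ (2 ^ n) ℚ.+_) (ιₙ-homo-+ (2 ^ n) 0) ⟨
  ιₙ (2 ^ n) ℚ.+ ιₙ (2 ^ n + 0)
    ≡⟨ ιₙ-homo-+ (2 ^ n) (2 ^ n + 0) ⟨
  ιₙ (2 ^ suc n) ∎
  where
  open ≡-Reasoning
  open +-*-Solver
  f : ℕ → ℚ
  f k = ιₙ (n C k)
  B = ∑[ k ≤ n ] f (toℕ k)

term-zero : ∀ n r .{{_ : NonZero r}} → term n r 0 ≡ 1ℚ
term-zero n r = trans (ℚ.*-identityʳ (+ r ℚ./ r))
  (ℚ*-cancelʳ-ι r {+ r ℚ./ r} {1ℚ} (trans (i/d*d≡i (+ r) r) (sym (ℚ.*-identityˡ (ιₙ r)))))

term-recurrence : ∀ n r k .{{_ : NonZero r}} →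
  ιₙ (suc r) ℚ.* term (suc n) r (suc k) ℚ.+ ιₙ (suc n) ℚ.* term n (suc r) k
  ≡ ιₙ (suc r) ℚ.* ιₙ (suc n C suc k)
term-recurrence n r k = ℚ*-cancelʳ-ι (suc k + r) (begin
  (r' ℚ.* (x ℚ.* c') ℚ.+ n' ℚ.* (y ℚ.* c)) ℚ.* d
    ≡⟨ solve 7 (λ r' x c' n' y c d → (r' :* (x :* c') :+ n' :* (y :* c)) :* d
         := r' :* c' :* (x :* d) :+ (y :* d) :* (n' :* c)) refl r' x c' n' y c d ⟩
  r' ℚ.* c' ℚ.* (x ℚ.* d) ℚ.+ (y ℚ.* d) ℚ.* (n' ℚ.* c)
    ≡⟨ cong₂ (λ s t → r' ℚ.* c' ℚ.* s ℚ.+ t ℚ.* (n' ℚ.* c)) (i/d*d≡i (+ r) (suc k + r)) yd ⟩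
  r' ℚ.* c' ℚ.* ιₙ r ℚ.+ r' ℚ.* (n' ℚ.* c)
    ≡⟨ cong (λ s → r' ℚ.* c' ℚ.* ιₙ r ℚ.+ r' ℚ.* s) absorb ⟩
  r' ℚ.* c' ℚ.* ιₙ r ℚ.+ r' ℚ.* (ιₙ (suc k) ℚ.* c')
    ≡⟨ solve 4 (λ r' c' r k' → r' :* c' :* r :+ r' :* (k' :* c') := r' :* c' :* (k' :+ r)) refl r' c' (ιₙ r) (ιₙ (suc k)) ⟩
  r' ℚ.* c' ℚ.* (ιₙ (suc k) ℚ.+ ιₙ r)
    ≡⟨ cong (r' ℚ.* c' ℚ.*_) (ιₙ-homo-+ (suc k) r) ⟨
  r' ℚ.* c' ℚ.* d ∎)
  where
  open ≡-Reasoning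
  open +-*-Solver
  instance
    _ = m+n≢0 (suc k) r
    _ = m+n≢0 k (suc r)
  r' = ιₙ (suc r)
  n' = ιₙ (suc n)
  c' = ιₙ (suc n C suc k)
  c  = ιₙ (n C k)
  d  = ιₙ (suc k + r)
  x = + r ℚ./ (suc k + r)
  y = + suc r ℚ./ (k + suc r)
  yd : y ℚ.* d ≡ r'
  yd = trans (cong (λ z → y ℚ.* ιₙ z) (sym (+-suc k r))) (i/d*d≡i (+ suc r) (k + suc r))
  absorb : n' ℚ.* c ≡ ιₙ (suc k) ℚ.* c'
  absorb = trans (sym (ιₙ-homo-* (suc n) (n C k)))
    (trans (cong ιₙ (sym ([1+k]*[1+n]C[1+k]≡[1+n]*nCk n k))) (ιₙ-homo-* (suc k) (suc n C suc k)))

-- Integration by parts in S n r = r ∫₀¹ xʳ⁻¹ (1 + x)ⁿ dx.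
S-recurrence : ∀ n r .{{_ : NonZero r}} →
  ιₙ (suc r) ℚ.* S (suc n) r ℚ.+ ιₙ (suc n) ℚ.* S n (suc r) ≡ ιₙ (suc r) ℚ.* ιₙ (2 ^ suc n)
S-recurrence n r = begin
  r' ℚ.* (h ℚ.+ sum t) ℚ.+ n' ℚ.* sum u
    ≡⟨ cong (λ z → r' ℚ.* (z ℚ.+ sum t) ℚ.+ n' ℚ.* sum u) (term-zero (suc n) r) ⟩
  r' ℚ.* (1ℚ ℚ.+ sum t) ℚ.+ n' ℚ.* sum u
    ≡⟨ solve 5 (λ r' o t n' u → r' :* (o :+ t) :+ n' :* u := r' :* o :+ (r' :* t :+ n' :* u)) refl r' 1ℚ (sum t) n' (sum u) ⟩
  r' ℚ.* 1ℚ ℚ.+ (r' ℚ.* sum t ℚ.+ n' ℚ.* sum u)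
    ≡⟨ cong (r' ℚ.* 1ℚ ℚ.+_) (cong₂ ℚ._+_ (*-distribˡ-sum r' t) (*-distribˡ-sum n' u)) ⟩
  r' ℚ.* 1ℚ ℚ.+ ((∑[ k ≤ n ] (r' ℚ.* t k)) ℚ.+ (∑[ k ≤ n ] (n' ℚ.* u k)))
    ≡⟨ cong (r' ℚ.* 1ℚ ℚ.+_) (∑-distrib-+ (λ k → r' ℚ.* t k) (λ k → n' ℚ.* u k)) ⟨
  r' ℚ.* 1ℚ ℚ.+ (∑[ k ≤ n ] (r' ℚ.* t k ℚ.+ n' ℚ.* u k))
    ≡⟨ cong (r' ℚ.* 1ℚ ℚ.+_) (sum-cong-≗ {suc n} (λ k → term-recurrence n r (toℕ k))) ⟩
  r' ℚ.* 1ℚ ℚ.+ (∑[ k ≤ n ] (r' ℚ.* c k))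
    ≡⟨ cong (r' ℚ.* 1ℚ ℚ.+_) (*-distribˡ-sum r' c) ⟨
  r' ℚ.* 1ℚ ℚ.+ r' ℚ.* sum c
    ≡⟨ ℚ.*-distribˡ-+ r' 1ℚ (sum c) ⟨
  r' ℚ.* (1ℚ ℚ.+ sum c)
    ≡⟨ cong (r' ℚ.*_) (∑nCk≡2^n (suc n)) ⟩
  r' ℚ.* ιₙ (2 ^ suc n) ∎
  where
  open ≡-Reasoning
  open +-*-Solver
  r' = ιₙ (suc r)
  n' = ιₙ (suc n)
  h = term (suc n) r 0
  t u c : Fin (suc n) → ℚ
  t k = term (suc n) r (suc (toℕ k))
  u k = term n (suc r) (toℕ k)
  c k = ιₙ (suc n C suc (toℕ k))

S*C≡T : ∀ n r .{{_ : NonZero r}} → S n r ℚ.* ιₙ ((n + r) C n) ≡ ι (T n (n + r))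
S*C≡T zero r = trans (ℚ.*-identityʳ _) (trans (ℚ.+-identityʳ _) (term-zero 0 r))
S*C≡T (suc n) r = ℚ*-cancelʳ-ι (suc r) (begin
  S (suc n) r ℚ.* c ℚ.* r'
    ≡⟨ solve 5 (λ s c r' n' s' → s :* c :* r' := (r' :* s :+ n' :* s') :* c :+ :- (s' :* (n' :* c))) refl (S (suc n) r) c r' n' s' ⟩
  (r' ℚ.* S (suc n) r ℚ.+ n' ℚ.* s') ℚ.* c ℚ.+ ℚ.- (s' ℚ.* (n' ℚ.* c))
    ≡⟨ cong₂ (λ a b → a ℚ.* c ℚ.+ ℚ.- (s' ℚ.* b)) (S-recurrence n r) absorb ⟩
  (r' ℚ.* P) ℚ.* c ℚ.+ ℚ.- (s' ℚ.* (r' ℚ.* c₀))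
    ≡⟨ solve 5 (λ r' P c s' c₀ → (r' :* P) :* c :+ :- (s' :* (r' :* c₀)) := (P :* c :+ :- (s' :* c₀)) :* r') refl r' P c s' c₀ ⟩
  (P ℚ.* c ℚ.+ ℚ.- (s' ℚ.* c₀)) ℚ.* r'
    ≡⟨ cong (λ z → (P ℚ.* c ℚ.+ ℚ.- z) ℚ.* r') ih ⟩
  (P ℚ.* c ℚ.+ ℚ.- ι t) ℚ.* r'
    ≡⟨ cong₂ (λ a b → (a ℚ.+ b) ℚ.* r') (sym (ιₙ-homo-* (2 ^ suc n) (N C suc n))) (ι-neg t) ⟩
  (ιₙ (2 ^ suc n * (N C suc n)) ℚ.+ ι (ℤ.- t)) ℚ.* r'
    ≡⟨ cong (ℚ._* r') (ι-homo-+ (+ (2 ^ suc n * (N C suc n))) (ℤ.- t)) ⟨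
  ι (T (suc n) N) ℚ.* r' ∎)
  where
  open ≡-Reasoning
  open +-*-Solver
  N = suc n + r
  r' = ιₙ (suc r)
  n' = ιₙ (suc n)
  c = ιₙ (N C suc n)
  c₀ = ιₙ (N C n)
  s' = S n (suc r)
  P = ιₙ (2 ^ suc n)
  t = T n N
  ι-neg : ∀ z → ℚ.- ι z ≡ ι (ℤ.- z)
  ι-neg z = begin
    ℚ.- ι z                          ≡⟨ solve 2 (λ a b → :- a := b :+ (:- (a :+ b))) refl (ι z) (ι (ℤ.- z)) ⟩
    ι (ℤ.- z) ℚ.+ ℚ.- (ι z ℚ.+ ι (ℤ.- z))   ≡⟨ cong (λ a → ι (ℤ.- z) ℚ.+ ℚ.- a) (ι-homo-+ z (ℤ.- z)) ⟨
    ι (ℤ.- z) ℚ.+ ℚ.- ι (z ℤ.+ ℤ.- z)       ≡⟨ cong (λ a → ι (ℤ.- z) ℚ.+ ℚ.- ι a) (ℤ.+-inverseʳ z) ⟩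
    ι (ℤ.- z) ℚ.+ 0ℚ                 ≡⟨ ℚ.+-identityʳ _ ⟩
    ι (ℤ.- z)                        ∎
  ih : s' ℚ.* c₀ ≡ ι t
  ih = subst (λ z → s' ℚ.* ιₙ (z C n) ≡ ι (T n z)) (+-suc n r) (S*C≡T n (suc r))
  absorb : n' ℚ.* c ≡ r' ℚ.* c₀
  absorb = trans (sym (ιₙ-homo-* (suc n) (N C suc n)))
    (trans (cong ιₙ (subst (λ z → suc n * (z C suc n) ≡ suc r * (z C n)) (+-suc n r) ([1+k]*[k+d]C[1+k]≡d*[k+d]Ck n (suc r))))
      (ιₙ-homo-* (suc r) (N C n)))

IsInteger⇒C∣T : ∀ n r .{{_ : NonZero r}} → IsInteger (S n r) → + ((n + r) C n) ℤ∣.∣ T n (n + r)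
IsInteger⇒C∣T n r (z , S≡z) = ℤ∣.divides z (ι-injective (begin
  ι (T n (n + r))                ≡⟨ S*C≡T n r ⟨
  S n r ℚ.* ιₙ ((n + r) C n)     ≡⟨ cong (ℚ._* ιₙ ((n + r) C n)) S≡z ⟩
  ι z ℚ.* ιₙ ((n + r) C n)       ≡⟨ ι-homo-* z (+ ((n + r) C n)) ⟨
  ι (z ℤ.* + ((n + r) C n))      ∎))
  where open ≡-Reasoning

prime-power-divisor : ∀ {p} → Prime p → ∀ e a {b} → p ∤ b → p ^ e ∣ a * b → p ^ e ∣ a
prime-power-divisor pr zero a p∤b _ = 1∣ a
prime-power-divisor {p} pr (suc e) a {b} p∤b q∣ab with euclidsLemma a b pr (m*n∣⇒m∣ p (p ^ e) q∣ab)
... | inj₂ p∣b = contradiction p∣b p∤b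
... | inj₁ (divides-refl a') = subst (p ^ suc e ∣_) (*-comm p a') (*-monoʳ-∣ p
        (prime-power-divisor pr e a' p∤b (*-cancelˡ-∣ p {{prime⇒nonZero pr}} (subst (p * p ^ e ∣_) (lem a' p b) q∣ab))))
  where
  lem : ∀ a p b → a * p * b ≡ p * (a * b)
  lem = solve-∀

prime∣mC[1+i] : ∀ {p} → Prime p → ∀ e {m i} → p ^ e ∣ m → suc i < p ^ e → p ∣ m C suc i
prime∣mC[1+i] {p} pr e {zero} {i} _ _ = p ∣0
prime∣mC[1+i] {p} pr e {suc m} {i} q∣m i<q = decidable-stable (p ∣? suc m C suc i) λ p∤C →
  <⇒≱ i<q (∣⇒≤ (prime-power-divisor pr e (suc i) p∤C
    (subst (p ^ e ∣_) (sym ([1+k]*[1+n]C[1+k]≡[1+n]*nCk m i)) (∣m⇒∣m*n (m C i) q∣m))))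

infix 4 _≡_[mod_]
_≡_[mod_] : ℤ → ℤ → ℕ → Set
a ≡ b [mod p ] = + p ℤ∣.∣ a ℤ.- b

+∣⇒∣ : ∀ {m n} → + m ℤ∣.∣ + n → m ∣ n
+∣⇒∣ = ℤ∣.∣⇒∣ᵤ

∣⇒+∣ : ∀ {m n} → m ∣ n → + m ℤ∣.∣ + n
∣⇒+∣ = ℤ∣.∣ᵤ⇒∣

≡mod-refl : ∀ {p} a → a ≡ a [mod p ]
≡mod-refl {p} a = subst (+ p ℤ∣.∣_) (sym (ℤ.+-inverseʳ a)) (∣⇒+∣ (p ∣0))

≡mod-pres-∣ʳ : ∀ {p a b} → a ≡ b [mod p ] → + p ℤ∣.∣ b → + p ℤ∣.∣ a
≡mod-pres-∣ʳ {p} {a} {b} a≡b p∣b = subst (+ p ℤ∣.∣_) (lem a b) (ℤ∣.∣m∣n⇒∣m+n a≡b p∣b)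
  where
  lem : ∀ a b → (a ℤ.- b) ℤ.+ b ≡ a
  lem = ℤ-solve-∀

≡mod-pres-∣ˡ : ∀ {p a b} → a ≡ b [mod p ] → + p ℤ∣.∣ a → + p ℤ∣.∣ b
≡mod-pres-∣ˡ {p} {a} {b} a≡b p∣a = subst (+ p ℤ∣.∣_) (lem a b) (ℤ∣.∣m∣n⇒∣m-n p∣a a≡b)
  where
  lem : ∀ a b → a ℤ.- (a ℤ.- b) ≡ b
  lem = ℤ-solve-∀

[m+t]Ci≡tCi : ∀ {p} → Prime p → ∀ e {m} → p ^ e ∣ m → ∀ t {i} → i < p ^ e →
  + ((m + t) C i) ≡ + (t C i) [mod p ]
[m+t]Ci≡tCi pr e q∣m t {zero} _ = ≡mod-refl (+ 1)
[m+t]Ci≡tCi {p} pr e {m} q∣m zero {suc i} i<q = ∣⇒+∣ {p} (subst (p ∣_)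
  (trans (cong (_C suc i) (sym (+-identityʳ m))) (sym (+-identityʳ _))) (prime∣mC[1+i] pr e q∣m i<q))
[m+t]Ci≡tCi {p} pr e {m} q∣m (suc t) {suc i} i<q = subst (+ p ℤ∣.∣_)
  (begin
    (+ ((m + t) C i) ℤ.- + (t C i)) ℤ.+ (+ ((m + t) C suc i) ℤ.- + (t C suc i))
      ≡⟨ lem (+ ((m + t) C i)) (+ (t C i)) (+ ((m + t) C suc i)) (+ (t C suc i)) ⟩
    (+ ((m + t) C i) ℤ.+ + ((m + t) C suc i)) ℤ.- (+ (t C i) ℤ.+ + (t C suc i))
      ≡⟨ cong₂ ℤ._-_ (pascal (m + t)) (pascal t) ⟩
    + (suc (m + t) C suc i) ℤ.- + (suc t C suc i)
      ≡⟨ cong (λ x → + (x C suc i) ℤ.- + (suc t C suc i)) (+-suc m t) ⟨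
    + ((m + suc t) C suc i) ℤ.- + (suc t C suc i) ∎)
  (ℤ∣.∣m∣n⇒∣m+n ([m+t]Ci≡tCi pr e q∣m t (<-trans (n<1+n i) i<q)) ([m+t]Ci≡tCi pr e q∣m t i<q))
  where
  open ≡-Reasoning
  lem : ∀ a b c d → (a ℤ.- b) ℤ.+ (c ℤ.- d) ≡ (a ℤ.+ c) ℤ.- (b ℤ.+ d)
  lem = ℤ-solve-∀
  pascal : ∀ n → + (n C i) ℤ.+ + (n C suc i) ≡ + (suc n C suc i)
  pascal n = trans (sym (ℤ.pos-+ (n C i) _)) (cong +_ (nCk+nC[k+1]≡[n+1]C[k+1] n i))

T[m+t]≡T[t] : ∀ {p} → Prime p → ∀ e {m} → p ^ e ∣ m → ∀ t {n} → n < p ^ e →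
  T n (m + t) ≡ T n t [mod p ]
T[m+t]≡T[t] pr e q∣m t {zero} _ = ≡mod-refl (+ 1)
T[m+t]≡T[t] {p} pr e {m} q∣m t {suc n} n<q = subst (+ p ℤ∣.∣_)
  (begin
    x ℤ.* (a ℤ.- b) ℤ.- (T n (m + t) ℤ.- T n t)       ≡⟨ lem x a b (T n (m + t)) (T n t) ⟩
    (x ℤ.* a ℤ.- T n (m + t)) ℤ.- (x ℤ.* b ℤ.- T n t) ≡⟨ cong₂ (λ u v → (u ℤ.- T n (m + t)) ℤ.- (v ℤ.- T n t))
                                                           (ℤ.pos-* (2 ^ suc n) _) (ℤ.pos-* (2 ^ suc n) _) ⟨
    T (suc n) (m + t) ℤ.- T (suc n) t                 ∎)
  (ℤ∣.∣m∣n⇒∣m-n (ℤ∣.∣n⇒∣m*n x ([m+t]Ci≡tCi pr e q∣m t n<q)) (T[m+t]≡T[t] pr e q∣m t (<-trans (n<1+n n) n<q)))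
  where
  open ≡-Reasoning
  x = + (2 ^ suc n)
  a = + ((m + t) C suc n)
  b = + (t C suc n)
  lem : ∀ x a b u v → x ℤ.* (a ℤ.- b) ℤ.- (u ℤ.- v) ≡ (x ℤ.* a ℤ.- u) ℤ.- (x ℤ.* b ℤ.- v)
  lem = ℤ-solve-∀

T[1+n][1+N] : ∀ n N → T (suc n) (suc N) ≡ + (2 ^ suc n * (N C suc n)) ℤ.+ T n N
T[1+n][1+N] zero N = begin
  + (2 * (suc N C 1)) ℤ.- + 1              ≡⟨ cong (λ x → + (2 * x) ℤ.- + 1) (nCk+nC[k+1]≡[n+1]C[k+1] N 0) ⟨
  + (2 * (1 + N C 1)) ℤ.- + 1              ≡⟨ cong (λ x → + x ℤ.- + 1) (*-distribˡ-+ 2 1 (N C 1)) ⟩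
  + (2 + 2 * (N C 1)) ℤ.- + 1              ≡⟨ cong (ℤ._- + 1) (ℤ.pos-+ 2 (2 * (N C 1))) ⟩
  + 2 ℤ.+ + (2 * (N C 1)) ℤ.- + 1          ≡⟨ lem (+ (2 * (N C 1))) ⟩
  + (2 * (N C 1)) ℤ.+ + 1                  ∎
  where
  open ≡-Reasoning
  lem : ∀ x → + 2 ℤ.+ x ℤ.- + 1 ≡ x ℤ.+ + 1
  lem x = trans (cong (ℤ._- + 1) (ℤ.+-comm (+ 2) x)) (ℤ.+-assoc x (+ 2) (ℤ.- + 1))
T[1+n][1+N] (suc n) N = begin
  + (2 * P * (suc N C suc (suc n))) ℤ.- T (suc n) (suc N)
    ≡⟨ cong₂ (λ x y → + (2 * P * x) ℤ.- y) (sym (nCk+nC[k+1]≡[n+1]C[k+1] N (suc n))) (T[1+n][1+N] n N) ⟩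
  + (2 * P * (N C suc n + N C suc (suc n))) ℤ.- (+ (P * (N C suc n)) ℤ.+ T n N)
    ≡⟨ cong (λ x → + x ℤ.- (+ (P * (N C suc n)) ℤ.+ T n N)) (lem₁ P (N C suc n) (N C suc (suc n))) ⟩
  + (P * (N C suc n) + P * (N C suc n) + 2 * P * (N C suc (suc n))) ℤ.- (+ (P * (N C suc n)) ℤ.+ T n N)
    ≡⟨ cong (λ x → x ℤ.- (+ (P * (N C suc n)) ℤ.+ T n N))
         (trans (ℤ.pos-+ (P * (N C suc n) + P * (N C suc n)) _) (cong (ℤ._+ + (2 * P * (N C suc (suc n)))) (ℤ.pos-+ (P * (N C suc n)) _))) ⟩
  + (P * (N C suc n)) ℤ.+ + (P * (N C suc n)) ℤ.+ + (2 * P * (N C suc (suc n))) ℤ.- (+ (P * (N C suc n)) ℤ.+ T n N)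
    ≡⟨ lem₂ (+ (P * (N C suc n))) (+ (2 * P * (N C suc (suc n)))) (T n N) ⟩
  + (2 * P * (N C suc (suc n))) ℤ.+ T (suc n) N ∎
  where
  open ≡-Reasoning
  P = 2 ^ suc n
  lem₁ : ∀ P a b → 2 * P * (a + b) ≡ P * a + P * a + 2 * P * b
  lem₁ = solve-∀
  lem₂ : ∀ x y z → x ℤ.+ x ℤ.+ y ℤ.- (x ℤ.+ z) ≡ y ℤ.+ (x ℤ.- z)
  lem₂ = ℤ-solve-∀

2^k*nCk≡0 : ∀ {n k} → n < k → + (2 ^ k * (n C k)) ≡ + 0
2^k*nCk≡0 {n} {k} n<k = cong +_ (trans (cong (2 ^ k *_) (k>n⇒nCk≡0 n<k)) (*-zeroʳ (2 ^ k)))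

T[1+n][1+t] : ∀ {n t} → t ≤ n → T (suc n) (suc t) ≡ T n t
T[1+n][1+t] {n} {t} t≤n = trans (T[1+n][1+N] n t)
  (trans (cong (ℤ._+ T n t) (2^k*nCk≡0 (s≤s t≤n))) (ℤ.+-identityˡ (T n t)))

T[t][t]≡1 : ∀ t → T t t ≡ + 1
T[t][t]≡1 zero = refl
T[t][t]≡1 (suc t) = trans (T[1+n][1+t] (≤-refl {t})) (T[t][t]≡1 t)

-- For t ≤ n the sum T n t runs over all of (1 − 2)ᵗ.
t≤n⇒∣T∣≡1 : ∀ {n t} → t ≤ n → ℤ.∣ T n t ∣ ≡ 1
t≤n⇒∣T∣≡1 {zero} z≤n = refl
t≤n⇒∣T∣≡1 {suc n} z≤n = begin
  ℤ.∣ + (2 ^ suc n * (0 C suc n)) ℤ.- T n 0 ∣   ≡⟨ cong (λ x → ℤ.∣ x ℤ.- T n 0 ∣) (2^k*nCk≡0 {0} {suc n} z<s) ⟩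
  ℤ.∣ + 0 ℤ.- T n 0 ∣                           ≡⟨ cong ℤ.∣_∣ (ℤ.+-identityˡ (ℤ.- T n 0)) ⟩
  ℤ.∣ ℤ.- T n 0 ∣                               ≡⟨ ℤ.∣-i∣≡∣i∣ (T n 0) ⟩
  ℤ.∣ T n 0 ∣                                   ≡⟨ t≤n⇒∣T∣≡1 {n} z≤n ⟩
  1                                             ∎
  where open ≡-Reasoning
t≤n⇒∣T∣≡1 (s≤s t≤n) = trans (cong ℤ.∣_∣ (T[1+n][1+t] t≤n)) (t≤n⇒∣T∣≡1 t≤n)

prime∤1 : ∀ {p} → Prime p → p ∤ 1
prime∤1 pr p∣1 = nonTrivial⇒≢1 {{prime⇒nonTrivial pr}} (∣1⇒≡1 p∣1)

prime∤T : ∀ {p} → Prime p → ∀ e {m} → p ^ e ∣ m → ∀ {t n} → t ≤ n → n < p ^ e → ¬ + p ℤ∣.∣ T n (m + t)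
prime∤T {p} pr e q∣m {t} t≤n n<q p∣T = prime∤1 pr
  (subst (p ∣_) (t≤n⇒∣T∣≡1 t≤n) (ℤ∣.∣⇒∣ᵤ (≡mod-pres-∣ˡ (T[m+t]≡T[t] pr e q∣m t n<q) p∣T)))

prime∣[m+t]Cn : ∀ {p} → Prime p → ∀ e {m} → p ^ e ∣ m → ∀ {t n} → t < n → n < p ^ e → p ∣ (m + t) C n
prime∣[m+t]Cn {p} pr e q∣m {t} {n} t<n n<q = +∣⇒∣ (≡mod-pres-∣ʳ ([m+t]Ci≡tCi pr e q∣m t n<q)
  (subst (λ x → + p ℤ∣.∣ + x) (sym (k>n⇒nCk≡0 t<n)) (∣⇒+∣ (p ∣0))))

S-notInteger : ∀ n r .{{_ : NonZero r}} {p} → p ∣ (n + r) C n → ¬ + p ℤ∣.∣ T n (n + r) → ¬ IsInteger (S n r)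
S-notInteger n r p∣C p∤T int = p∤T (ℤ∣.∣-trans (∣⇒+∣ p∣C) (IsInteger⇒C∣T n r int))

least-prime-factor : ∀ n .{{_ : NonTrivial n}} → ∃[ p ] Prime p × p ∣ n × p Rough n
least-prime-factor n = search (n ∸ 2) 2 (m∸n+n≡m (nonTrivial⇒n>1 n)) 2-rough
  where
  search : ∀ k m .{{_ : NonTrivial m}} → k + m ≡ n → m Rough n → ∃[ p ] Prime p × p ∣ n × p Rough n
  search k m eq rough with m ∣? n
  ... | yes m∣n = m , rough∧∣⇒prime rough m∣n , m∣n , rough
  search zero m refl rough | no m∤n = contradiction ∣-refl m∤n
  search (suc k) m@(2+ _) eq rough | no m∤n = search k (suc m) (trans (+-suc k m) eq) (∤⇒rough-suc m∤n rough)

n<m^n : ∀ m .{{_ : NonTrivial m}} n → n < m ^ n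
n<m^n m zero = z<s
n<m^n m (suc n) = begin
  suc (suc n)        ≤⟨ s≤s (n<m^n m n) ⟩
  suc (m ^ n)        ≤⟨ +-monoˡ-≤ (m ^ n) (m^n>0 m n) ⟩
  m ^ n + m ^ n      ≡⟨ cong (_+_ (m ^ n)) (+-identityʳ (m ^ n)) ⟨
  2 * m ^ n          ≤⟨ *-monoˡ-≤ (m ^ n) (nonTrivial⇒n>1 m) ⟩
  m * m ^ n          ∎
  where
  open ≤-Reasoning
  instance _ = nonTrivial⇒nonZero m

-- A prime p dividing m / gcd m L would give pᵉ ∣ m ⇒ pᵉ ∣ gcd m L ⇒ pᵉ⁺¹ ∣ m for all e.
prime-powers⇒∣ : ∀ m .{{_ : NonZero m}} {L} →
  (∀ p e → Prime p → p ^ e ∣ m → p ^ e ∣ L) → m ∣ L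
prime-powers⇒∣ m {L} pp with gcd[m,n]∣m m L
... | divides 0 eq = contradiction eq (≢-nonZero⁻¹ m)
... | divides 1 eq = subst (_∣ L) (trans (sym (*-identityˡ (gcd m L))) (sym eq)) (gcd[m,n]∣n m L)
... | divides (2+ c) eq with least-prime-factor (2+ c)
...   | p , pr , p∣c , _ = contradiction (∣⇒≤ (all-powers m)) (<⇒≱ (n<m^n p {{prime⇒nonTrivial pr}} m))
  where
  all-powers : ∀ e → p ^ e ∣ m
  all-powers zero = 1∣ m
  all-powers (suc e) = subst (p * p ^ e ∣_) (sym eq)
    (*-pres-∣ p∣c (gcd-greatest (all-powers e) (pp p e pr (all-powers e))))

0<nCk : ∀ {n k} → k ≤ n → 0 < n C k
0<nCk {n} {zero} _ = z<s
0<nCk {suc n} {suc k} (s≤s k≤n) = <-≤-trans (0<nCk k≤n)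
  (subst (n C k ≤_) (nCk+nC[k+1]≡[n+1]C[k+1] n k) (m≤m+n (n C k) (n C suc k)))

[1+n]Ck≤2^n : ∀ n k → suc n C k ≤ 2 ^ n
[1+n]Ck≤2^n n zero = m^n>0 2 n
[1+n]Ck≤2^n zero (suc zero) = ≤-refl
[1+n]Ck≤2^n zero (suc (suc k)) = z≤n
[1+n]Ck≤2^n (suc n) (suc k) = begin
  suc (suc n) C suc k            ≡⟨ nCk+nC[k+1]≡[n+1]C[k+1] (suc n) k ⟨
  suc n C k + suc n C suc k      ≤⟨ +-mono-≤ ([1+n]Ck≤2^n n k) ([1+n]Ck≤2^n n (suc k)) ⟩
  2 ^ n + 2 ^ n                  ≡⟨ cong (_+_ (2 ^ n)) (+-identityʳ (2 ^ n)) ⟨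
  2 ^ suc n                      ∎
  where open ≤-Reasoning

-- A prime power q with ⌈M/2⌉ < q ≤ M leaves remainder M − q < ⌊M/2⌋, so its prime divides M C ⌊M/2⌋.
small-common-multiple : ∀ m →
  ∃[ L ] 0 < L × L ≤ 2 ^ (m + m) × (∀ {k} → 0 < k → k ≤ suc m → k ∣ L)
small-common-multiple = <-rec _ step
  where
  step : ∀ m → (∀ {i} → i < m → ∃[ L ] 0 < L × L ≤ 2 ^ (i + i) × (∀ {k} → 0 < k → k ≤ suc i → k ∣ L)) →
    ∃[ L ] 0 < L × L ≤ 2 ^ (m + m) × (∀ {k} → 0 < k → k ≤ suc m → k ∣ L)
  step zero _ = 1 , z<s , ≤-refl , λ 0<k k≤1 → ∣-reflexive (≤-antisym k≤1 0<k)
  step m@(suc m') rec with rec {⌊ m /2⌋} (⌊n/2⌋<n m')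
  ... | L , 0<L , L≤ , k∣L = (M C a) * L , *-mono-≤ (0<nCk a≤M) 0<L , bound , divisible
    where
    M = suc m
    a = ⌈ m /2⌉
    b = suc ⌊ m /2⌋
    b+a≡M : b + a ≡ M
    b+a≡M = cong suc (⌊n/2⌋+⌈n/2⌉≡n m)
    a≤M : a ≤ M
    a≤M = subst (a ≤_) b+a≡M (m≤n+m a b)
    a≤b : a ≤ b
    a≤b = ⌊n/2⌋≤⌈n/2⌉ (suc m)
    bound : (M C a) * L ≤ 2 ^ (m + m)
    bound = begin
      (M C a) * L                              ≤⟨ *-mono-≤ ([1+n]Ck≤2^n m a) L≤ ⟩
      2 ^ m * 2 ^ (⌊ m /2⌋ + ⌊ m /2⌋)        ≡⟨ ^-distribˡ-+-* 2 m (⌊ m /2⌋ + ⌊ m /2⌋) ⟨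
      2 ^ (m + (⌊ m /2⌋ + ⌊ m /2⌋))          ≤⟨ ^-monoʳ-≤ 2 (+-monoʳ-≤ m (+-monoʳ-≤ ⌊ m /2⌋ (⌊n/2⌋≤⌈n/2⌉ m))) ⟩
      2 ^ (m + (⌊ m /2⌋ + ⌈ m /2⌉))          ≡⟨ cong (λ x → 2 ^ (m + x)) (⌊n/2⌋+⌈n/2⌉≡n m) ⟩
      2 ^ (m + m)                            ∎
      where open ≤-Reasoning
    prime-power : ∀ p e → Prime p → p ^ e ≤ M → p ^ e ∣ (M C a) * L
    prime-power p e pr q≤M with p ^ e ≤? b
    ... | yes q≤b = ∣n⇒∣m*n (M C a) (k∣L (m^n>0 p {{prime⇒nonZero pr}} e) q≤b)
    prime-power p zero pr q≤M | no q≰b = contradiction (s≤s z≤n) q≰b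
    prime-power p (suc e) pr q≤M | no q≰b = *-pres-∣
        (subst (λ x → p ∣ x C a) q+t≡M (prime∣[m+t]Cn pr (suc e) ∣-refl t<a (≤-<-trans a≤b b<q)))
        (k∣L (m^n>0 p {{prime⇒nonZero pr}} e) (*-cancelˡ-≤ 2 2p^e≤2b))
      where
      b<q = ≰⇒> q≰b
      t = M ∸ p ^ suc e
      q+t≡M : p ^ suc e + t ≡ M
      q+t≡M = m+[n∸m]≡n q≤M
      t<a : t < a
      t<a = +-cancelˡ-< b t a (subst (b + t <_) (trans q+t≡M (sym b+a≡M)) (+-monoˡ-< t b<q))
      2p^e≤2b : 2 * p ^ e ≤ 2 * b
      2p^e≤2b = begin
        2 * p ^ e      ≤⟨ *-monoˡ-≤ (p ^ e) (nonTrivial⇒n>1 p {{prime⇒nonTrivial pr}}) ⟩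
        p ^ suc e      ≤⟨ q≤M ⟩
        M              ≡⟨ b+a≡M ⟨
        b + a          ≤⟨ +-monoʳ-≤ b a≤b ⟩
        b + b          ≡⟨ cong (_+_ b) (+-identityʳ b) ⟨
        2 * b          ∎
        where open ≤-Reasoning
    divisible : ∀ {k} → 0 < k → k ≤ M → k ∣ (M C a) * L
    divisible {suc k} _ k≤M = prime-powers⇒∣ (suc k) λ p e pr q∣k → prime-power p e pr (≤-trans (∣⇒≤ q∣k) k≤M)

-- The reciprocals of G form the Leibniz harmonic triangle: 1/G n r = 1/G (1+n) r + 1/G n (1+r).
G : ℕ → ℕ → ℕ
G n r = suc (n + r) * ((n + r) C n)

G-step-n : ∀ n r → suc n * G (suc n) r ≡ (suc (suc n) + r) * G n r
G-step-n n r = begin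
  suc n * ((suc (suc n) + r) * c)  ≡⟨ lem (suc n) (suc (suc n) + r) c ⟩
  (suc (suc n) + r) * (suc n * c)  ≡⟨ cong ((suc (suc n) + r) *_) ([1+k]*[1+n]C[1+k]≡[1+n]*nCk (n + r) n) ⟩
  (suc (suc n) + r) * G n r        ∎
  where
  open ≡-Reasoning
  c = (suc n + r) C suc n
  lem : ∀ a b c → a * (b * c) ≡ b * (a * c)
  lem = solve-∀

G-step-r : ∀ n r → suc n * G (suc n) r ≡ suc r * G n (suc r)
G-step-r n r = begin
  suc n * (suc (suc n + r) * ((suc n + r) C suc n))
    ≡⟨ cong (λ x → suc n * (suc x * (x C suc n))) (+-suc n r) ⟨
  suc n * (suc N * (N C suc n))
    ≡⟨ lem (suc n) (suc N) (N C suc n) ⟩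
  suc N * (suc n * (N C suc n))
    ≡⟨ cong (suc N *_) ([1+k]*[k+d]C[1+k]≡d*[k+d]Ck n (suc r)) ⟩
  suc N * (suc r * (N C n))
    ≡⟨ lem (suc N) (suc r) (N C n) ⟩
  suc r * G n (suc r) ∎
  where
  open ≡-Reasoning
  N = n + suc r
  lem : ∀ a b c → a * (b * c) ≡ b * (a * c)
  lem = solve-∀

G∣common-multiple : ∀ n r {L} → (∀ {j} → j ≤ n → suc r + j ∣ L) → G n r ∣ L
G∣common-multiple zero r {L} h = subst (_∣ L) (trans (+-identityʳ (suc r)) (sym (*-identityʳ (suc r)))) (h z≤n)
G∣common-multiple (suc n) r {L} h = *-cancelˡ-∣ (suc n) (∣m+n∣m⇒∣n
  (subst₂ _∣_ (sym (G-step-n n r)) (lem n r L)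
    (*-monoʳ-∣ (suc (suc n) + r) (G∣common-multiple n r (λ j≤n → h (m≤n⇒m≤1+n j≤n)))))
  (subst (_∣ suc r * L) (sym (G-step-r n r))
    (*-monoʳ-∣ (suc r) (G∣common-multiple n (suc r) (λ {j} j≤n → subst (_∣ L) (+-suc (suc r) j) (h (s≤s j≤n)))))))
  where
  lem : ∀ n r L → (2 + n + r) * L ≡ (1 + r) * L + (1 + n) * L
  lem = solve-∀

2^[n+n]*[1+s]≤G : ∀ n s → 2 ^ (n + n) * suc s ≤ G n (n + s)
2^[n+n]*[1+s]≤G zero s = ≤-reflexive (*-comm 1 (suc s))
2^[n+n]*[1+s]≤G (suc n) s = *-cancelˡ-≤ (suc r * suc n) (begin
  suc r * suc n * (2 ^ (suc n + suc n) * suc s)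
    ≡⟨ cong (λ x → suc r * suc n * (2 ^ suc x * suc s)) (+-suc n n) ⟩
  suc r * suc n * (2 * (2 * 2 ^ (n + n)) * suc s)
    ≡⟨ lem₁ (suc r) (suc n) (2 ^ (n + n)) (suc s) ⟩
  4 * (suc n * suc r) * (2 ^ (n + n) * suc s)
    ≤⟨ *-mono-≤ (m≤m+n (4 * (suc n * suc r)) (s * s + (2 * n + s + 2))) (2^[n+n]*[1+s]≤G n s) ⟩
  (4 * (suc n * suc r) + (s * s + (2 * n + s + 2))) * G n r
    ≡⟨ cong (_* G n r) (lem₂ n s) ⟩
  (suc (suc n) + suc r) * (suc (suc n) + r) * G n r
    ≡⟨ *-assoc (suc (suc n) + suc r) (suc (suc n) + r) (G n r) ⟩
  (suc (suc n) + suc r) * ((suc (suc n) + r) * G n r)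
    ≡⟨ cong ((suc (suc n) + suc r) *_) (trans (sym (G-step-n n r)) (G-step-r n r)) ⟩
  (suc (suc n) + suc r) * (suc r * G n (suc r))
    ≡⟨ lem₃ (suc (suc n) + suc r) (suc r) (G n (suc r)) ⟩
  suc r * ((suc (suc n) + suc r) * G n (suc r))
    ≡⟨ cong (suc r *_) (G-step-n n (suc r)) ⟨
  suc r * (suc n * G (suc n) (suc r))
    ≡⟨ *-assoc (suc r) (suc n) _ ⟨
  suc r * suc n * G (suc n) (suc n + s) ∎)
  where
  open ≤-Reasoning
  r = n + s
  lem₁ : ∀ a b x c → a * b * (2 * (2 * x) * c) ≡ 4 * (b * a) * (x * c)
  lem₁ = solve-∀
  lem₂ : ∀ n s → 4 * ((1 + n) * (1 + (n + s))) + (s * s + (2 * n + s + 2)) ≡ (2 + n + (1 + (n + s))) * (2 + n + (n + s))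
  lem₂ = solve-∀
  lem₃ : ∀ a b c → a * (b * c) ≡ b * (a * c)
  lem₃ = solve-∀

n<r⇒S-notInteger : ∀ (n r : ℕ) .{{_ : NonZero r}} → 1 ≤ n → n ≤ r ∸ 1 → ¬ IsInteger (S n r)
n<r⇒S-notInteger (suc n) r@(suc r') 1≤n n<r int with small-common-multiple n
... | L , 0<L , L≤ , k∣L = <⇒≱ (begin-strict
    2 ^ (n + n)               <⟨ m<m*n (2 ^ (n + n)) (suc s) {{m^n≢0 2 (n + n)}} (s≤s 0<s) ⟩
    2 ^ (n + n) * suc s       ≤⟨ 2^[n+n]*[1+s]≤G n s ⟩
    G n (n + s)               ≡⟨ cong (G n) (m+[n∸m]≡n n≤r) ⟩
    G n r                     ∎) (≤-trans (∣⇒≤ {{>-nonZero 0<L}} (G∣common-multiple n r all∣L)) L≤)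
  where
  open ≤-Reasoning
  n≤r : n ≤ r
  n≤r = ≤-trans (n≤1+n n) (≤-trans n<r (n≤1+n r'))
  s = r ∸ n
  0<s : 0 < s
  0<s = m<n⇒0<n∸m (≤-trans n<r (n≤1+n r'))
  all∣L : ∀ {j} → j ≤ n → suc r + j ∣ L
  all∣L {j} j≤n = prime-powers⇒∣ (suc r + j) prime-power
    where
    t = n ∸ j
    m+t≡n+r : (suc r + j) + t ≡ suc n + r
    m+t≡n+r = begin-equality
      suc r + j + t      ≡⟨ +-assoc (suc r) j t ⟩
      suc r + (j + t)    ≡⟨ cong (_+_ (suc r)) (m+[n∸m]≡n j≤n) ⟩
      suc r + n          ≡⟨ +-comm (suc r) n ⟩
      n + suc r          ≡⟨ +-suc n r ⟩
      suc n + r          ∎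
    t<1+n : t < suc n
    t<1+n = s≤s (m∸n≤m n j)
    prime-power : ∀ p e → Prime p → p ^ e ∣ suc r + j → p ^ e ∣ L
    prime-power p e pr q∣m with p ^ e ≤? suc n
    ... | yes q≤n = k∣L (m^n>0 p {{prime⇒nonZero pr}} e) q≤n
    ... | no q≰n = contradiction int (S-notInteger (suc n) r {p}
      (subst (λ x → p ∣ x C suc n) m+t≡n+r (prime∣[m+t]Cn pr e q∣m t<1+n (≰⇒> q≰n)))
      (subst (λ x → ¬ + p ℤ∣.∣ T (suc n) x) m+t≡n+r (prime∤T pr e q∣m (<⇒≤ t<1+n) (≰⇒> q≰n))))

nCk≡nCl : ∀ {n} k l → k + l ≡ n → n C k ≡ n C l
nCk≡nCl k l refl = trans (nCk≡nC[n∸k] (m≤m+n k l)) (cong ((k + l) C_) (m+n∸m≡n k l))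

p^1∣ : ∀ {p m} → p ∣ m → p ^ 1 ∣ m
p^1∣ {p} = subst (_∣ _) (sym (*-identityʳ p))

<p^1 : ∀ {p n} → n < p → n < p ^ 1
<p^1 {p} = subst (_ <_) (sym (*-identityʳ p))

T[n][1+n]≡2^[1+n]-1 : ∀ n → T n (suc n) ≡ + (2 ^ suc n) ℤ.- + 1
T[n][1+n]≡2^[1+n]-1 n = begin
  T n (suc n)                                ≡⟨ lem (+ (2 ^ suc n)) (T n (suc n)) ⟩
  + (2 ^ suc n) ℤ.- (+ (2 ^ suc n) ℤ.- T n (suc n))
    ≡⟨ cong (λ x → + (2 ^ suc n) ℤ.- (+ x ℤ.- T n (suc n))) (trans (cong (2 ^ suc n *_) (nCn≡1 (suc n))) (*-identityʳ (2 ^ suc n))) ⟨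
  + (2 ^ suc n) ℤ.- T (suc n) (suc n)        ≡⟨ cong (λ x → + (2 ^ suc n) ℤ.- x) (T[t][t]≡1 (suc n)) ⟩
  + (2 ^ suc n) ℤ.- + 1                      ∎
  where
  open ≡-Reasoning
  lem : ∀ a t → t ≡ a ℤ.- (a ℤ.- t)
  lem = ℤ-solve-∀

prime∣T⇒∣2^m-1 : ∀ {p} → Prime p → ∀ {m} .{{_ : NonZero m}} → p ∣ m → ∀ t ρ n → t ≤ ρ → ρ < p →
  n + suc ρ ≡ m + t → + p ℤ∣.∣ T n (m + t) → + p ℤ∣.∣ + (2 ^ m) ℤ.- + 1
prime∣T⇒∣2^m-1 {p} pr {m} p∣m zero zero n _ _ eq p∣T = subst (+ p ℤ∣.∣_)
  (trans (cong (T n) (sym 1+n≡m+0)) (trans (T[n][1+n]≡2^[1+n]-1 n)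
    (cong (λ x → + (2 ^ x) ℤ.- + 1) (trans 1+n≡m+0 (+-identityʳ m))))) p∣T
  where
  1+n≡m+0 : suc n ≡ m + 0
  1+n≡m+0 = trans (+-comm 1 n) eq
prime∣T⇒∣2^m-1 {p} pr {m} p∣m zero (suc ρ) n _ ρ<p eq p∣T =
  prime∣T⇒∣2^m-1 pr p∣m zero ρ (suc n) z≤n (<-trans (n<1+n ρ) ρ<p) eq′
    (ℤ∣.∣m∣n⇒∣m-n (∣⇒+∣ (∣n⇒∣m*n (2 ^ suc n) p∣C)) p∣T)
  where
  eq′ : suc n + suc ρ ≡ m + 0
  eq′ = trans (sym (+-suc n (suc ρ))) eq
  p∣C : p ∣ (m + 0) C suc n
  p∣C = subst (p ∣_) (sym (nCk≡nCl (suc n) (suc ρ) eq′)) (subst (λ x → p ∣ x C suc ρ) (sym (+-identityʳ m))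
    (prime∣mC[1+i] pr 1 (p^1∣ p∣m) (<p^1 ρ<p)))
prime∣T⇒∣2^m-1 {p} pr {m} p∣m (suc t) ρ zero _ ρ<p eq _ =
  contradiction (subst (_≤ p) (trans eq (+-suc m t)) ρ<p) (<⇒≱ (s≤s (≤-trans (∣⇒≤ p∣m) (m≤m+n m t))))
prime∣T⇒∣2^m-1 {p} pr {m} p∣m (suc t) ρ (suc n) t<ρ ρ<p eq p∣T =
  prime∣T⇒∣2^m-1 pr p∣m t ρ n (<⇒≤ t<ρ) ρ<p eq′
    (ℤ∣.∣m+n∣m⇒∣n {+ p} {+ (2 ^ suc n * ((m + t) C suc n))} (subst (+ p ℤ∣.∣_) (trans (cong (T (suc n)) (+-suc m t)) (T[1+n][1+N] n (m + t))) p∣T)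
      (∣⇒+∣ (∣n⇒∣m*n (2 ^ suc n) p∣C)))
  where
  eq′ : n + suc ρ ≡ m + t
  eq′ = suc-injective (trans eq (+-suc m t))
  p∣C : p ∣ (m + t) C suc n
  p∣C = subst (p ∣_) (sym (nCk≡nCl (suc n) ρ (trans (sym (+-suc n ρ)) eq′)))
    (prime∣[m+t]Cn pr 1 (p^1∣ p∣m) t<ρ (<p^1 ρ<p))

∣2^a-1⇒∣2^[x*a]-1 : ∀ {p} a → + p ℤ∣.∣ + (2 ^ a) ℤ.- + 1 → ∀ x → + p ℤ∣.∣ + (2 ^ (x * a)) ℤ.- + 1
∣2^a-1⇒∣2^[x*a]-1 {p} a h zero = ∣⇒+∣ (p ∣0)
∣2^a-1⇒∣2^[x*a]-1 {p} a h (suc x) = subst (+ p ℤ∣.∣_) (begin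
  u ℤ.* (v ℤ.- + 1) ℤ.+ (u ℤ.- + 1)       ≡⟨ lem u v (+ 1) (ℤ.*-identityʳ u) ⟩
  u ℤ.* v ℤ.- + 1                         ≡⟨ cong (ℤ._- + 1) (ℤ.pos-* (2 ^ a) _) ⟨
  + (2 ^ a * 2 ^ (x * a)) ℤ.- + 1         ≡⟨ cong (λ z → + z ℤ.- + 1) (^-distribˡ-+-* 2 a (x * a)) ⟨
  + (2 ^ (a + x * a)) ℤ.- + 1             ∎)
  (ℤ∣.∣m∣n⇒∣m+n (ℤ∣.∣n⇒∣m*n u (∣2^a-1⇒∣2^[x*a]-1 a h x)) h)
  where
  open ≡-Reasoning
  u = + (2 ^ a)
  v = + (2 ^ (x * a))
  lem′ : ∀ u v o → u ℤ.* (v ℤ.- o) ℤ.+ (u ℤ.* o ℤ.- o) ≡ u ℤ.* v ℤ.- o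
  lem′ = ℤ-solve-∀
  lem : ∀ u v o → u ℤ.* o ≡ u → u ℤ.* (v ℤ.- o) ℤ.+ (u ℤ.- o) ≡ u ℤ.* v ℤ.- o
  lem u v o e = trans (cong (λ z → u ℤ.* (v ℤ.- o) ℤ.+ (z ℤ.- o)) (sym e)) (lem′ u v o)

2^[1+a]-2≡2*[2^a-1] : ∀ a → + (2 ^ suc a) ℤ.- + 2 ≡ + 2 ℤ.* (+ (2 ^ a) ℤ.- + 1)
2^[1+a]-2≡2*[2^a-1] a = trans (cong (ℤ._- + 2) (ℤ.pos-* 2 (2 ^ a))) (sym (ℤ.*-distribˡ-+ (+ 2) (+ (2 ^ a)) (ℤ.- + 1)))

¬consecutive-exponents : ∀ {p} → Prime p → ∀ {a b} → 1 + a ≡ b →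
  + p ℤ∣.∣ + (2 ^ a) ℤ.- + 1 → ¬ + p ℤ∣.∣ + (2 ^ b) ℤ.- + 1
¬consecutive-exponents {p} pr {a} refl ha hb = prime∤1 pr (+∣⇒∣ (subst (+ p ℤ∣.∣_) (begin
  (x ℤ.- + 1) ℤ.- + 2 ℤ.* (+ (2 ^ a) ℤ.- + 1)    ≡⟨ cong (λ z → (x ℤ.- + 1) ℤ.- z) (2^[1+a]-2≡2*[2^a-1] a) ⟨
  (x ℤ.- + 1) ℤ.- (x ℤ.- + 2)                    ≡⟨ lem x (+ 1) (+ 2) ⟩
  + 1                                            ∎)
  (ℤ∣.∣m∣n⇒∣m-n hb (ℤ∣.∣n⇒∣m*n (+ 2) ha))))
  where
  open ≡-Reasoning
  x = + (2 ^ suc a)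
  lem : ∀ x y z → (x ℤ.- y) ℤ.- (x ℤ.- z) ≡ z ℤ.- y
  lem = ℤ-solve-∀

prime∣2^⇒∣2 : ∀ {p} → Prime p → ∀ a → p ∣ 2 ^ a → p ∣ 2
prime∣2^⇒∣2 pr zero p∣1 = contradiction p∣1 (prime∤1 pr)
prime∣2^⇒∣2 pr (suc a) h with euclidsLemma 2 (2 ^ a) pr h
... | inj₁ p∣2 = p∣2
... | inj₂ p∣2^a = prime∣2^⇒∣2 pr a p∣2^a

∣i∣≡1⇒i≡±1 : ∀ i → ℤ.∣ i ∣ ≡ 1 → i ≡ + 1 ⊎ i ≡ ℤ.- + 1
∣i∣≡1⇒i≡±1 (+ _) refl = inj₁ refl
∣i∣≡1⇒i≡±1 ℤ.-[1+ _ ] refl = inj₂ refl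

-- Fermat: T (p − 1) p is both 2ᵖ − 1 and, modulo p, T (p − 1) 0 = ±1.
fermat-2 : ∀ {p-1} → Prime (suc p-1) → suc p-1 ∤ 2 → + suc p-1 ℤ∣.∣ + (2 ^ p-1) ℤ.- + 1
fermat-2 {p-1} pr p∤2 = conclude (∣i∣≡1⇒i≡±1 (T p-1 0) (t≤n⇒∣T∣≡1 {p-1} z≤n))
  where
  p = suc p-1
  x = + (2 ^ p)
  2^p-1-T≡0 : + p ℤ∣.∣ x ℤ.- + 1 ℤ.- T p-1 0
  2^p-1-T≡0 = subst (λ z → + p ℤ∣.∣ z ℤ.- T p-1 0)
    (trans (cong (T p-1) (+-identityʳ p)) (T[n][1+n]≡2^[1+n]-1 p-1)) (T[m+t]≡T[t] pr 1 (p^1∣ ∣-refl) 0 (<p^1 (n<1+n p-1)))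
  conclude : T p-1 0 ≡ + 1 ⊎ T p-1 0 ≡ ℤ.- + 1 → + p ℤ∣.∣ + (2 ^ p-1) ℤ.- + 1
  conclude (inj₂ T≡-1) = contradiction (prime∣2^⇒∣2 pr p (+∣⇒∣ (subst (+ p ℤ∣.∣_)
    (trans (cong (λ z → x ℤ.- + 1 ℤ.- z) T≡-1) (trans (ℤ.+-assoc x (ℤ.- + 1) (+ 1)) (ℤ.+-identityʳ x))) 2^p-1-T≡0))) p∤2
  conclude (inj₁ T≡1) with euclidsLemma 2 ℤ.∣ + (2 ^ p-1) ℤ.- + 1 ∣ pr
      (subst (p ∣_) (ℤ.∣i*j∣≡∣i∣*∣j∣ (+ 2) (+ (2 ^ p-1) ℤ.- + 1)) (ℤ∣.∣⇒∣ᵤ (subst (+ p ℤ∣.∣_) 2^p-2 2^p-1-T≡0)))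
    where
    2^p-2 : x ℤ.- + 1 ℤ.- T p-1 0 ≡ + 2 ℤ.* (+ (2 ^ p-1) ℤ.- + 1)
    2^p-2 = trans (cong (λ z → x ℤ.- + 1 ℤ.- z) T≡1)
      (trans (ℤ.+-assoc x (ℤ.- + 1) (ℤ.- + 1)) (2^[1+a]-2≡2*[2^a-1] p-1))
  ... | inj₁ p∣2 = contradiction p∣2 p∤2
  ... | inj₂ h = ℤ∣.∣ᵤ⇒∣ h

least-prime∤2^m-1 : ∀ {p} → Prime p → ∀ {m} .{{_ : NonZero m}} → p ∣ m → p Rough m →
  ¬ + p ℤ∣.∣ + (2 ^ m) ℤ.- + 1
least-prime∤2^m-1 {zero} pr = contradiction pr ¬prime[0]
least-prime∤2^m-1 {suc p-1} pr {m@(suc m')} p∣m rough h = bezout (coprime-Bézout coprime)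
  where
  p = suc p-1
  instance _ = prime⇒nonTrivial pr
  p∤2 : p ∤ 2
  p∤2 p∣2 = prime∤1 pr (+∣⇒∣ (subst (+ p ℤ∣.∣_) (lem (+ (2 ^ m)) (+ 1))
    (ℤ∣.∣m∣n⇒∣m-n (∣⇒+∣ (∣m⇒∣m*n (2 ^ m') p∣2)) h)))
    where
    lem : ∀ x o → x ℤ.- (x ℤ.- o) ≡ o
    lem = ℤ-solve-∀
  coprime : Coprime m p-1
  coprime {zero} (0∣m , _) = contradiction (0∣⇒≡0 0∣m) λ ()
  coprime {suc zero} _ = refl
  coprime {2+ d} (d∣m , d∣p-1) = contradiction
    (hasNonTrivialDivisor (s≤s (∣⇒≤ {{>-nonZero (s≤s⁻¹ (nonTrivial⇒n>1 p))}} d∣p-1)) d∣m) rough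
  h′ = fermat-2 pr p∤2
  bezout : ¬ Bézout.Identity 1 m p-1
  bezout (Bézout.+- x y eq) = ¬consecutive-exponents pr eq
    (∣2^a-1⇒∣2^[x*a]-1 p-1 h′ y) (∣2^a-1⇒∣2^[x*a]-1 m h x)
  bezout (Bézout.-+ x y eq) = ¬consecutive-exponents pr eq
    (∣2^a-1⇒∣2^[x*a]-1 m h x) (∣2^a-1⇒∣2^[x*a]-1 p-1 h′ y)

2∤T : ∀ n N → ¬ + 2 ℤ∣.∣ T n N
2∤T zero N h = prime∤1 prime[2] (+∣⇒∣ h)
2∤T (suc n) N h = 2∤T n N (subst (+ 2 ℤ∣.∣_) (lem (+ (2 ^ suc n * (N C suc n))) (T n N))
  (ℤ∣.∣m∣n⇒∣m-n (∣⇒+∣ (∣m⇒∣m*n (N C suc n) (m∣m*n (2 ^ n)))) h))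
  where
  lem : ∀ a t → a ℤ.- (a ℤ.- t) ≡ t
  lem = ℤ-solve-∀

prime∣[1+N]C[1+n] : ∀ {p} → Prime p → ∀ {n N} → p ∣ suc N → p ∤ suc n → p ∣ suc N C suc n
prime∣[1+N]C[1+n] {p} pr {n} {N} p∣N p∤n with euclidsLemma (suc n) (suc N C suc n) pr
  (subst (p ∣_) (sym ([1+k]*[1+n]C[1+k]≡[1+n]*nCk N n)) (∣m⇒∣m*n (N C n) p∣N))
... | inj₁ p∣n = contradiction p∣n p∤n
... | inj₂ p∣C = p∣C

2∤∧2∤⇒2∣+ : ∀ m n → 2 ∤ m → 2 ∤ n → 2 ∣ m + n
2∤∧2∤⇒2∣+ zero n h _ = contradiction (2 ∣0) h
2∤∧2∤⇒2∣+ (suc m) zero _ h = contradiction (2 ∣0) h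
2∤∧2∤⇒2∣+ (suc zero) (suc zero) _ _ = ∣-refl
2∤∧2∤⇒2∣+ (2+ m) n@(suc _) hm hn = ∣m∣n⇒∣m+n ∣-refl (2∤∧2∤⇒2∣+ m n (λ h → hm (∣m∣n⇒∣m+n ∣-refl h)) hn)
2∤∧2∤⇒2∣+ (suc zero) (2+ n) hm hn = subst (2 ∣_) (+-comm (2+ n) 1)
  (∣m∣n⇒∣m+n {n = n + 1} ∣-refl (subst (2 ∣_) (+-comm 1 n) (2∤∧2∤⇒2∣+ 1 n hm (λ h → hn (∣m∣n⇒∣m+n ∣-refl h)))))

abstract
  residues : ∀ {c} → c < 60 → ∀ {r} → r < 7 → 0 < r →
    (2 ∤ c × 2 ∤ r) ⊎ (∃[ j ] j < r × (∀ {d} → d < 7 → 2 ≤ d → d ≤ r → d ∤ c + suc j))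
  residues = from-yes (allUpTo? (λ c → allUpTo? (λ r → (0 <? r) →-dec
    ((¬? (2 ∣? c) ×-dec ¬? (2 ∣? r)) ⊎-dec
     anyUpTo? (λ j → allUpTo? (λ d → (2 ≤? d) →-dec ((d ≤? r) →-dec ¬? (d ∣? c + suc j))) 7) r)) 7) 60)

  d∣60 : ∀ {d} → d < 7 → 2 ≤ d → d ∣ 60
  d∣60 = from-yes (allUpTo? (λ d → (2 ≤? d) →-dec (d ∣? 60)) 7)

r≤6⇒S-notInteger : ∀ (n r : ℕ) .{{_ : NonZero r}} → r ≤ 6 → 2 ≤ n → ¬ IsInteger (S n r)
r≤6⇒S-notInteger n@(suc n') r@(suc ρ) r≤6 2≤n with residues (m%n<n n 60) (s≤s r≤6) z<s
... | inj₁ (2∤c , 2∤r) = S-notInteger n r {2}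
    (prime∣[1+N]C[1+n] prime[2] (2∤∧2∤⇒2∣+ n r 2∤n 2∤r) 2∤n) (2∤T n (n + r))
  where
  2∤n : 2 ∤ n
  2∤n 2∣n = 2∤c (∣m+n∣m⇒∣n (subst (2 ∣_) (trans (m≡m%n+[m/n]*n n 60) (+-comm (n % 60) _)) 2∣n)
    (∣n⇒∣m*n (n / 60) (d∣60 (s≤s (s≤s (s≤s z≤n))) ≤-refl)))
... | inj₂ (j , j<r , no-divisor) with least-prime-factor (n + suc j)
  {{n>1⇒nonTrivial (≤-trans 2≤n (m≤m+n n (suc j)))}}
...   | p , pr , p∣m , rough = S-notInteger n r {p} p∣C
    λ p∣T → least-prime∤2^m-1 pr p∣m rough (prime∣T⇒∣2^m-1 pr p∣m t ρ n (m∸n≤m ρ j) (<⇒≤ r<p) (sym m+t≡n+r)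
      (subst (λ x → + p ℤ∣.∣ T n x) (sym m+t≡n+r) p∣T))
  where
  m = n + suc j
  t = ρ ∸ j
  m+t≡n+r : m + t ≡ n + r
  m+t≡n+r = trans (+-assoc n (suc j) t) (cong (λ x → n + suc x) (m+[n∸m]≡n (s≤s⁻¹ j<r)))
  r<p : r < p
  r<p = ≰⇒> λ p≤r →
    let p<7 = s≤s (≤-trans p≤r r≤6)
        2≤p = nonTrivial⇒n>1 p {{prime⇒nonTrivial pr}}
    in no-divisor p<7 2≤p p≤r (∣m+n∣m⇒∣n
      (subst (p ∣_) (trans (cong (_+ suc j) (trans (m≡m%n+[m/n]*n n 60) (+-comm (n % 60) _))) (+-assoc (n / 60 * 60) (n % 60) (suc j))) p∣m)
      (∣n⇒∣m*n (n / 60) (d∣60 p<7 2≤p)))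
  p∣C : p ∣ (n + r) C n
  p∣C = subst (p ∣_) (sym (nCk≡nCl n r refl)) (subst (λ x → p ∣ x C r) m+t≡n+r
    (prime∣[m+t]Cn pr 1 (p^1∣ p∣m) (s≤s (m∸n≤m ρ j)) (<p^1 r<p)))

theorem2 : (∀ (n r : ℕ) .{{_ : NonZero r}} → r ≤ 6 → 2 ≤ n → ¬ IsInteger (S n r))
    × (∀ (n r : ℕ) .{{_ : NonZero r}} → 1 ≤ n → n ≤ r ∸ 1 → ¬ IsInteger (S n r))
theorem2 = r≤6⇒S-notInteger , n<r⇒S-notInteger
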